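{- Let $a,c,n$ be integers with $c\ge 1$ odd, $n\ge 2$ and $1\le a\le 2^n$. Then $$\nu_2\big(S(c2^n,\,(c-1)2^n+a)\big)=s_2(a)-1.$$
   Context: $S(n,k)$ denotes the Stirling number of the second kind: the number of partitions of an $n$-element set into exactly $k$ nonempty subsets. $\nu_2(m)$ denotes the 2-adic valuation of $m$ (the exponent of the highest power of 2 dividing $m$). $s_2(m)$ denotes the sum of the binary digits of the nonnegative integer $m$. -}

module Defs where

open import Data.Digit using (toDigits)
open import Data.Fin using (Fin; toℕ)
open import Data.Fin.Properties using (all?)
open import Data.Fin.Subset using (Subset; inside; outside; _∈_; _∩_; Nonempty; Empty)
open import Data.Fin.Subset.Properties using (_∈?_; nonempty?)
open import Data.List using (List; []; _∷_; _++_; map; filter; length)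
open import Data.List.Relation.Unary.All as All using (All)
open import Data.List.Relation.Unary.AllPairs as AllPairs using (AllPairs)
open import Data.List.Relation.Unary.Any as Any using (Any)
open import Data.Nat using (ℕ; zero; suc; _^_; _≤_; _≟_)
open import Data.Nat.Divisibility using (_∣_)
open import Data.Nat.ListAction using (sum)
open import Data.Product using (_×_; proj₁)
import Data.Vec as Vec
open import Relation.Binary.PropositionalEquality using (_≡_)
open import Relation.Nullary using (Dec)
open import Relation.Nullary.Decidable using (_×-dec_; ¬?)

sublists : ∀ {A : Set} → List A → List (List A)
sublists []       = [] ∷ []
sublists (x ∷ xs) = sublists xs ++ map (x ∷_) (sublists xs)

-- Every subset of Fin n, each listed exactly once.
subsets : ∀ n → List (Subset n)
subsets zero    = Vec.[] ∷ []
subsets (suc n) = map (outside Vec.∷_) (subsets n) ++ map (inside Vec.∷_) (subsets n)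

Disjoint : ∀ {n} → Subset n → Subset n → Set
Disjoint p q = Empty (p ∩ q)

-- Nonempty pairwise disjoint blocks are distinct, so `length P` is the
-- number of blocks.
IsPartition : ∀ {n} → ℕ → List (Subset n) → Set
IsPartition k P =
  length P ≡ k × All Nonempty P × AllPairs Disjoint P × (∀ x → Any (x ∈_) P)

isPartition? : ∀ {n} k (P : List (Subset n)) → Dec (IsPartition k P)
isPartition? k P =
  (length P ≟ k)
  ×-dec All.all? nonempty? P
  ×-dec AllPairs.allPairs? (λ p q → ¬? (nonempty? (p ∩ q))) P
  ×-dec all? (λ x → Any.any? (x ∈?_) P)

-- Stirling number of the second kind.  Since `subsets n` has no repetitions,
-- each set of subsets of Fin n occurs exactly once, in a fixed order of its
-- members, in `sublists (subsets n)`; so partitions are counted as unordered.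
S : ℕ → ℕ → ℕ
S n k = length (filter (isPartition? k) (sublists (subsets n)))

-- ν₂ as a relation: v is the exponent of the highest power of 2 dividing m.
-- No v satisfies it when m = 0, so it also asserts that m is nonzero.
infix 4 ν₂[_]≡_
ν₂[_]≡_ : ℕ → ℕ → Set
ν₂[ m ]≡ v = 2 ^ v ∣ m × (∀ j → 2 ^ j ∣ m → j ≤ v)

s₂ : ℕ → ℕ
s₂ m = sum (map toℕ (proj₁ (toDigits 2 m)))

{-# OPTIONS --safe #-}
module Submission where

-- In k! Σ S(N,k) tᴺ/N! = (eᵗ − 1)ᵏ put t = 2u.  By Legendre's formula
-- (e^(2u) − 1)/2 = Σ_{j≥1} 2^(j−1) uʲ/j! has 2-integral coefficients, and the
-- j-th one is odd exactly when j is a power of 2.  Hence, with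
-- g = Σᵣ u^(2^r), S(N,k) is a 2-adic unit times 2^(s₂ k − s₂ N) x, where
-- x ≡ [uᴺ] gᵏ (mod 2).  Since g² ≡ g + u, Pascal's rule gives
-- [uᴺ] gᵏ ≡ C(2N − k, N) (mod 2).  For N = c 2ⁿ and k = (c − 1) 2ⁿ + a we have
-- 2N − k = N + m with m = 2ⁿ − a < 2ⁿ, so no carry occurs in N + m and the
-- binomial coefficient is odd, while s₂ k − s₂ N = s₂ a − 1.

open import Defs
open import Algebra.Properties.CommutativeSemigroup using (x∙yz≈y∙xz)
open import Data.Bool using (true; false; if_then_else_)
open import Data.Digit using (Expansion; toDigits; fromDigits)
open import Data.Fin using (Fin; zero; suc; toℕ)
open import Data.Fin.Subset using (Subset; inside; outside; _∈_; Nonempty; Empty)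
open import Data.Fin.Subset.Properties
  using (drop-∷-Empty; nonempty?; drop-there; ∩-comm; x∈p∩q⁺; x∈p∩q⁻)
open import Data.List using (List; []; _∷_; _++_; map; filter; length; [_])
open import Data.List.Properties using (map-++; map-∘; map-cong; length-map)
open import Data.List.Relation.Binary.Permutation.Propositional
  using (_↭_; refl; prep; swap; ↭-trans; ↭-sym; ↭⇒↭ₛ)
open import Data.List.Relation.Binary.Permutation.Propositional.Properties
  using (All-resp-↭; Any-resp-↭; ↭-length; ++-comm)
import Data.List.Relation.Binary.Permutation.Setoid.Properties as Permutation
open import Data.List.Relation.Unary.All as All using (All; []; _∷_)
import Data.List.Relation.Unary.All.Properties as All
open import Data.List.Relation.Unary.AllPairs as AllPairs using (AllPairs; []; _∷_)
import Data.List.Relation.Unary.AllPairs.Properties as AllPairs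
open import Data.List.Relation.Unary.Any as Any using (Any; here; there)
import Data.List.Relation.Unary.Any.Properties as Any
open import Data.Nat
  using (ℕ; zero; suc; _+_; _*_; _∸_; _^_; _≤_; _<_; z≤n; s≤s; parity; _!)
open import Data.Nat.Combinatorics
  using (_C_; nCk≡n!/k![n-k]!; k![n∸k]!∣n!; nCk+nC[k+1]≡[n+1]C[k+1]; nCk≡nC[n∸k])
open import Data.Nat.Divisibility using (_∣_; _∤_; divides; m∣m*n; *-cancelˡ-∣)
open import Data.Nat.DivMod using (m/n*n≡m)
open import Data.Nat.Induction using (<-rec)
open import Data.Nat.ListAction using (sum)
open import Data.Nat.ListAction.Properties using (sum-++)
open import Data.Nat.Properties
open import Data.Nat.Tactic.RingSolver using (solve-∀)
open import Data.Parity as ℙ using (0ℙ; 1ℙ)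
open import Data.Parity.Properties as ℙ using (+-homo-+; *-homo-*)
open import Data.Product using (∃; _×_; _,_; proj₁; proj₂)
open import Data.Sum using (_⊎_; inj₁; inj₂)
import Data.Vec as Vec
open import Function using (_∘_)
open import Relation.Binary.PropositionalEquality hiding ([_])
open import Relation.Nullary using (Dec; yes; no; does; ¬_; contradiction)
open import Relation.Nullary.Decidable using (¬?; _×-dec_)
open import Relation.Unary using (Decidable)

-- Finite sums and indicators

-- `S` is a count, so the generating function is only reached through the recurrence `S-rec`, and
-- every power series identity below is an identity between natural number coefficients. What shapes
-- the proof is that ℕ has no 2-adic units to divide by. Each unit is kept as an explicit odd
-- cofactor, and equations are multiplied by powers of 2 instead of divided. With h = (e^(2u) -
-- 1)/2, the number `surj′ k n` is [uⁿ] hᵏ times the odd part of n!. That normalisation makes the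
-- convolution weights depend on both indices; modulo 2 the dependence on the second one disappears.
--
-- The congruence g² ≡ g + u comes from the exact identity h(u)² + h(u) = h(2u)/2, whose right side
-- has j-th coefficient 2^(j-1) times that of h, hence is congruent to u modulo 2. The identity
-- needs only the surjection numbers onto one and two points.

∑ : ∀ {A : Set} → (A → ℕ) → List A → ℕ
∑ f xs = sum (map f xs)

∑-++ : ∀ {A : Set} (f : A → ℕ) xs ys → ∑ f (xs ++ ys) ≡ ∑ f xs + ∑ f ys
∑-++ f xs ys = trans (cong sum (map-++ f xs ys)) (sum-++ (map f xs) (map f ys))

∑-map : ∀ {A B : Set} (f : B → ℕ) (g : A → B) xs → ∑ f (map g xs) ≡ ∑ (f ∘ g) xs
∑-map f g xs = cong sum (sym (map-∘ xs))

∑-cong : ∀ {A : Set} {f g : A → ℕ} → f ≗ g → ∑ f ≗ ∑ g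
∑-cong f≗g xs = cong sum (map-cong f≗g xs)

∑-+ : ∀ {A : Set} (f g : A → ℕ) xs → ∑ (λ x → f x + g x) xs ≡ ∑ f xs + ∑ g xs
∑-+ f g []       = refl
∑-+ f g (x ∷ xs) = trans (cong (f x + g x +_) (∑-+ f g xs)) (shuffle (f x) (g x) _ _)
  where
  shuffle : ∀ a b c d → a + b + (c + d) ≡ a + c + (b + d)
  shuffle = solve-∀

∑-*ʳ : ∀ {A : Set} (f : A → ℕ) c xs → ∑ (λ x → f x * c) xs ≡ ∑ f xs * c
∑-*ʳ f c []       = refl
∑-*ʳ f c (x ∷ xs) = trans (cong (f x * c +_) (∑-*ʳ f c xs)) (sym (*-distribʳ-+ c (f x) _))

∑-*ˡ : ∀ {A : Set} c (f : A → ℕ) xs → ∑ (λ x → c * f x) xs ≡ c * ∑ f xs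
∑-*ˡ c f xs = begin
  ∑ (λ x → c * f x) xs  ≡⟨ ∑-cong (λ x → *-comm c (f x)) xs ⟩
  ∑ (λ x → f x * c) xs  ≡⟨ ∑-*ʳ f c xs ⟩
  ∑ f xs * c            ≡⟨ *-comm _ c ⟩
  c * ∑ f xs            ∎
  where open ≡-Reasoning

∑-zero : ∀ {A : Set} (f : A → ℕ) → (∀ x → f x ≡ 0) → ∀ xs → ∑ f xs ≡ 0
∑-zero f f≡0 []       = refl
∑-zero f f≡0 (x ∷ xs) = cong₂ _+_ (f≡0 x) (∑-zero f f≡0 xs)

indicator : ∀ {P : Set} → Dec P → ℕ
indicator d = if does d then 1 else 0

indicator-cong : ∀ {P Q : Set} (d : Dec P) (e : Dec Q) → (P → Q) → (Q → P) →
  indicator d ≡ indicator e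
indicator-cong (yes p) (yes q) f g = refl
indicator-cong (yes p) (no ¬q) f g = contradiction (f p) ¬q
indicator-cong (no ¬p) (yes q) f g = contradiction (g q) ¬p
indicator-cong (no ¬p) (no ¬q) f g = refl

indicator-no : ∀ {P : Set} (d : Dec P) → ¬ P → indicator d ≡ 0
indicator-no (yes p) ¬p = contradiction p ¬p
indicator-no (no  _) ¬p = refl

indicator-yes : ∀ {P : Set} (d : Dec P) → P → indicator d ≡ 1
indicator-yes (yes _) p = refl
indicator-yes (no ¬p) p = contradiction p ¬p

-- Weights matter only where the indicator is 1; this lets `length P` become the constant `suc k` on
-- partitions into `suc k` blocks.
indicator-weight : ∀ {P : Set} (d : Dec P) {x y} → (P → x ≡ y) → x * indicator d ≡ y * indicator d
indicator-weight (yes p) x≡y = cong (_* 1) (x≡y p)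
indicator-weight (no _) {x} {y} _ = trans (*-zeroʳ x) (sym (*-zeroʳ y))

indicator-× : ∀ {P Q : Set} (d : Dec P) (e : Dec Q) →
  indicator (d ×-dec e) ≡ indicator d * indicator e
indicator-× (yes _) (yes _) = refl
indicator-× (yes _) (no  _) = refl
indicator-× (no  _) _       = refl

indicator-⊎ : ∀ {P Q R : Set} (d : Dec P) (e : Dec Q) (f : Dec R) →
  (P → Q ⊎ R) → (Q → P) → (R → P) → (Q → ¬ R) →
  indicator d ≡ indicator e + indicator f
indicator-⊎ d (yes q) f to q→p r→p q→¬r =
  trans (indicator-yes d (q→p q)) (cong suc (sym (indicator-no f (q→¬r q))))
indicator-⊎ {P} {Q} {R} d (no ¬q) f to q→p r→p q→¬r = indicator-cong d f p→r r→p
  where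
  p→r : P → R
  p→r p with to p
  ... | inj₁ q = contradiction q ¬q
  ... | inj₂ r = r

length-filter : ∀ {A : Set} {P : A → Set} (P? : Decidable P) xs →
  length (filter P? xs) ≡ ∑ (λ x → indicator (P? x)) xs
length-filter P? []       = refl
length-filter P? (x ∷ xs) with does (P? x)
... | true  = cong suc (length-filter P? xs)
... | false = length-filter P? xs

-- Sums over sublists

∑-sublists-∷ : ∀ {A : Set} (F : List A → ℕ) x xs →
  ∑ F (sublists (x ∷ xs)) ≡ ∑ F (sublists xs) + ∑ (F ∘ (x ∷_)) (sublists xs)
∑-sublists-∷ F x xs =
  trans (∑-++ F (sublists xs) _) (cong (_ +_) (∑-map F (x ∷_) (sublists xs)))

∑-sublists-++ : ∀ {A : Set} (F : List A → ℕ) xs ys →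
  ∑ F (sublists (xs ++ ys)) ≡ ∑ (λ as → ∑ (λ bs → F (as ++ bs)) (sublists ys)) (sublists xs)
∑-sublists-++ F []       ys = sym (+-identityʳ _)
∑-sublists-++ F (x ∷ xs) ys = begin
  ∑ F (sublists (x ∷ xs ++ ys))
    ≡⟨ ∑-sublists-∷ F x (xs ++ ys) ⟩
  ∑ F (sublists (xs ++ ys)) + ∑ (F ∘ (x ∷_)) (sublists (xs ++ ys))
    ≡⟨ cong₂ _+_ (∑-sublists-++ F xs ys) (∑-sublists-++ (F ∘ (x ∷_)) xs ys) ⟩
  ∑ G (sublists xs) + ∑ (G ∘ (x ∷_)) (sublists xs)
    ≡⟨ ∑-sublists-∷ G x xs ⟨
  ∑ G (sublists (x ∷ xs)) ∎
  where
  open ≡-Reasoning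
  G = λ as → ∑ (λ bs → F (as ++ bs)) (sublists ys)

sublists-map : ∀ {A B : Set} (f : A → B) xs → sublists (map f xs) ≡ map (map f) (sublists xs)
sublists-map f []       = refl
sublists-map f (x ∷ xs) = begin
  sublists (map f xs) ++ map (f x ∷_) (sublists (map f xs))
    ≡⟨ cong (λ ls → ls ++ map (f x ∷_) ls) (sublists-map f xs) ⟩
  map (map f) (sublists xs) ++ map (f x ∷_) (map (map f) (sublists xs))
    ≡⟨ cong (map (map f) (sublists xs) ++_) (trans (sym (map-∘ (sublists xs))) (map-∘ (sublists xs))) ⟩
  map (map f) (sublists xs) ++ map (map f) (map (x ∷_) (sublists xs))
    ≡⟨ map-++ (map f) (sublists xs) _ ⟨
  map (map f) (sublists (x ∷ xs)) ∎
  where open ≡-Reasoning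

∑-sublists-nil : ∀ {A : Set} (F : List A → ℕ) → (∀ x xs → F (x ∷ xs) ≡ 0) →
  ∀ xs → ∑ F (sublists xs) ≡ F []
∑-sublists-nil F F∷≡0 []       = +-identityʳ _
∑-sublists-nil F F∷≡0 (x ∷ xs) = begin
  ∑ F (sublists (x ∷ xs))
    ≡⟨ ∑-sublists-∷ F x xs ⟩
  ∑ F (sublists xs) + ∑ (F ∘ (x ∷_)) (sublists xs)
    ≡⟨ cong₂ _+_ (∑-sublists-nil F F∷≡0 xs) (∑-zero _ (F∷≡0 x) (sublists xs)) ⟩
  F [] + 0
    ≡⟨ +-identityʳ _ ⟩
  F [] ∎
  where open ≡-Reasoning

∑-sublists-singletons : ∀ {A : Set} (F : List A → ℕ) →
  F [] ≡ 0 → (∀ x y zs → F (x ∷ y ∷ zs) ≡ 0) →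
  ∀ xs → ∑ F (sublists xs) ≡ ∑ (λ x → F [ x ]) xs
∑-sublists-singletons F F[]≡0 F∷∷≡0 []       = cong (_+ 0) F[]≡0
∑-sublists-singletons F F[]≡0 F∷∷≡0 (x ∷ xs) = begin
  ∑ F (sublists (x ∷ xs))
    ≡⟨ ∑-sublists-∷ F x xs ⟩
  ∑ F (sublists xs) + ∑ (F ∘ (x ∷_)) (sublists xs)
    ≡⟨ cong₂ _+_ (∑-sublists-singletons F F[]≡0 F∷∷≡0 xs)
                 (∑-sublists-nil (F ∘ (x ∷_)) (F∷∷≡0 x) xs) ⟩
  ∑ (λ y → F [ y ]) xs + F [ x ]
    ≡⟨ +-comm _ (F [ x ]) ⟩
  ∑ (λ y → F [ y ]) (x ∷ xs) ∎
  where open ≡-Reasoning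

-- Double counting of the pairs of a sublist and one of its members.
∑-sublists-insert : ∀ {A : Set} (F : List A → ℕ) →
  (∀ {xs ys} → xs ↭ ys → F xs ≡ F ys) → (∀ x xs → F (x ∷ x ∷ xs) ≡ 0) →
  ∀ xs → ∑ (λ as → ∑ (λ b → F (b ∷ as)) xs) (sublists xs)
       ≡ ∑ (λ as → length as * F as) (sublists xs)
∑-sublists-insert F F-↭ F-dup []       = refl
∑-sublists-insert F F-↭ F-dup (x ∷ xs) = begin
  ∑ (λ as → ∑ (λ b → F (b ∷ as)) (x ∷ xs)) (sublists (x ∷ xs))
    ≡⟨ ∑-sublists-∷ _ x xs ⟩
  ∑ (λ as → F (x ∷ as) + ∑ (λ b → F (b ∷ as)) xs) (sublists xs)
    + ∑ (λ as → F (x ∷ x ∷ as) + ∑ (λ b → F (b ∷ x ∷ as)) xs) (sublists xs)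
    ≡⟨ cong₂ _+_ (∑-+ _ _ (sublists xs)) (∑-cong swapped (sublists xs)) ⟩
  (∑ F′ (sublists xs) + ∑ (λ as → ∑ (λ b → F (b ∷ as)) xs) (sublists xs))
    + ∑ (λ as → ∑ (λ b → F′ (b ∷ as)) xs) (sublists xs)
    ≡⟨ cong₂ (λ u v → (∑ F′ (sublists xs) + u) + v)
         (∑-sublists-insert F F-↭ F-dup xs)
         (∑-sublists-insert F′ (F-↭ ∘ prep x) F′-dup xs) ⟩
  (∑ F′ (sublists xs) + ∑ (λ as → length as * F as) (sublists xs))
    + ∑ (λ as → length as * F′ as) (sublists xs)
    ≡⟨ shuffle (∑ F′ (sublists xs)) _ _ ⟩
  ∑ (λ as → length as * F as) (sublists xs)
    + (∑ F′ (sublists xs) + ∑ (λ as → length as * F′ as) (sublists xs))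
    ≡⟨ cong (∑ (λ as → length as * F as) (sublists xs) +_) (∑-+ _ _ (sublists xs)) ⟨
  ∑ (λ as → length as * F as) (sublists xs)
    + ∑ (λ as → suc (length as) * F′ as) (sublists xs)
    ≡⟨ ∑-sublists-∷ (λ as → length as * F as) x xs ⟨
  ∑ (λ as → length as * F as) (sublists (x ∷ xs)) ∎
  where
  open ≡-Reasoning
  F′ = F ∘ (x ∷_)
  F′-dup : ∀ y ys → F′ (y ∷ y ∷ ys) ≡ 0
  F′-dup y ys = trans (F-↭ (↭-trans (swap x y refl) (prep y (swap x y refl)))) (F-dup y (x ∷ ys))
  swapped : ∀ as → F (x ∷ x ∷ as) + ∑ (λ b → F (b ∷ x ∷ as)) xs ≡ ∑ (λ b → F′ (b ∷ as)) xs
  swapped as = cong₂ _+_ (F-dup x as) (∑-cong (λ b → F-↭ (swap b x refl)) xs)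
  shuffle : ∀ a b c → a + b + c ≡ b + (a + c)
  shuffle = solve-∀

-- The recurrence of the Stirling numbers

Disjoint-sym : ∀ {n} {p q : Subset n} → Disjoint p q → Disjoint q p
Disjoint-sym {p = p} {q} = subst Empty (∩-comm p q)

-- A sublist lists its blocks in a fixed order, whereas the recurrence puts the block of `zero`
-- first; the count must not see the difference.
IsPartition-resp-↭ : ∀ {n k} {P Q : List (Subset n)} → P ↭ Q → IsPartition k P → IsPartition k Q
IsPartition-resp-↭ {n} P↭Q (len , nonempty , disjoint , cover) =
    trans (sym (↭-length P↭Q)) len
  , All-resp-↭ P↭Q nonempty
  , Permutation.AllPairs-resp-↭ (setoid (Subset n)) (λ {p} {q} → Disjoint-sym {p = p} {q})
      (resp₂ Disjoint) (↭⇒↭ₛ P↭Q) disjoint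
  , λ x → Any-resp-↭ P↭Q (cover x)

Empty-outside : ∀ {n} {p : Subset n} → Empty p → Empty (outside Vec.∷ p)
Empty-outside empty (suc x , Vec.there x∈p) = empty (x , x∈p)

Nonempty-outside : ∀ {n} {p : Subset n} → Nonempty (outside Vec.∷ p) → Nonempty p
Nonempty-outside (suc x , Vec.there x∈p) = x , x∈p

Nonempty-∷ : ∀ {n s} {p : Subset n} → Nonempty p → Nonempty (s Vec.∷ p)
Nonempty-∷ (x , x∈p) = suc x , Vec.there x∈p

module _ {n k : ℕ} (b : Subset n) (as : List (Subset n)) where

  -- `inside ∷ b` is the one block containing `zero`. Deleting `zero` from it leaves `b`: if `b` is
  -- empty, the block was a singleton and `as` alone partitions the remaining points; otherwise
  -- `b ∷ as` does.
  Lifted : Set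
  Lifted = IsPartition (suc k) ((inside Vec.∷ b) ∷ map (outside Vec.∷_) as)

  drop-zero : Lifted → (Empty b × IsPartition k as) ⊎ IsPartition (suc k) (b ∷ as)
  drop-zero (len , _ ∷ nonempty , disjoint-b ∷ disjoint , cover) with nonempty? b
  ... | yes b≠∅ = inj₂
    ( cong suc len-as
    , b≠∅ ∷ nonempty-as
    , All.map drop-∷-Empty (All.map⁻ disjoint-b) ∷ disjoint-as
    , λ x → cover-as x (cover (suc x)))
    where
    len-as = trans (sym (length-map (outside Vec.∷_) as)) (suc-injective len)
    nonempty-as = All.map Nonempty-outside (All.map⁻ nonempty)
    disjoint-as = AllPairs.map drop-∷-Empty (AllPairs.map⁻ disjoint)
    cover-as : ∀ x → Any (suc x ∈_) ((inside Vec.∷ b) ∷ map (outside Vec.∷_) as) →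
      Any (x ∈_) (b ∷ as)
    cover-as x (here x∈b)  = here (drop-there x∈b)
    cover-as x (there any) = there (Any.map drop-there (Any.map⁻ any))
  ... | no b=∅ = inj₁
    ( b=∅
    , trans (sym (length-map (outside Vec.∷_) as)) (suc-injective len)
    , All.map Nonempty-outside (All.map⁻ nonempty)
    , AllPairs.map drop-∷-Empty (AllPairs.map⁻ disjoint)
    , λ x → cover-as x (cover (suc x)))
    where
    cover-as : ∀ x → Any (suc x ∈_) ((inside Vec.∷ b) ∷ map (outside Vec.∷_) as) →
      Any (x ∈_) as
    cover-as x (here x∈b)  = contradiction (x , drop-there x∈b) b=∅
    cover-as x (there any) = Any.map drop-there (Any.map⁻ any)

  add-singleton : Empty b × IsPartition k as → Lifted
  add-singleton (b=∅ , len , nonempty , disjoint , cover) =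
      cong suc (trans (length-map (outside Vec.∷_) as) len)
    , (zero , Vec.here) ∷ All.map⁺ (All.map Nonempty-∷ nonempty)
    , All.map⁺ (All.universal (λ p → Empty-outside λ (x , x∈b∩p) → b=∅ (x , proj₁ (x∈p∩q⁻ b p x∈b∩p))) as)
        ∷ AllPairs.map⁺ (AllPairs.map Empty-outside disjoint)
    , λ { zero    → here Vec.here
        ; (suc x) → there (Any.map⁺ (Any.map Vec.there (cover x))) }

  add-to-block : IsPartition (suc k) (b ∷ as) → Lifted
  add-to-block (len , _ ∷ nonempty , disjoint-b ∷ disjoint , cover) =
      cong suc (trans (length-map (outside Vec.∷_) as) (suc-injective len))
    , (zero , Vec.here) ∷ All.map⁺ (All.map Nonempty-∷ nonempty)
    , All.map⁺ (All.map Empty-outside disjoint-b) ∷ AllPairs.map⁺ (AllPairs.map Empty-outside disjoint)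
    , λ { zero    → here Vec.here
        ; (suc x) → cover-lifted x (cover x) }
    where
    cover-lifted : ∀ x → Any (x ∈_) (b ∷ as) →
      Any (suc x ∈_) ((inside Vec.∷ b) ∷ map (outside Vec.∷_) as)
    cover-lifted x (here x∈b)  = here (Vec.there x∈b)
    cover-lifted x (there any) = there (Any.map⁺ (Any.map Vec.there any))

isEmpty? : ∀ {n} → Decidable (Empty {n})
isEmpty? b = ¬? (nonempty? b)

-- Ensures that the singleton block of `zero` is counted once for each partition `as` of the
-- remaining points.
count-empty : ∀ n → ∑ (λ b → indicator (isEmpty? b)) (subsets n) ≡ 1
count-empty zero    = refl
count-empty (suc n) = begin
  ∑ E (subsets (suc n))
    ≡⟨ ∑-++ E (map (outside Vec.∷_) (subsets n)) _ ⟩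
  ∑ E (map (outside Vec.∷_) (subsets n)) + ∑ E (map (inside Vec.∷_) (subsets n))
    ≡⟨ cong₂ _+_ (∑-map E _ (subsets n)) (∑-map E _ (subsets n)) ⟩
  ∑ (E ∘ (outside Vec.∷_)) (subsets n) + ∑ (E ∘ (inside Vec.∷_)) (subsets n)
    ≡⟨ cong₂ _+_
         (trans (∑-cong same (subsets n)) (count-empty n))
         (∑-zero _ nonempty (subsets n)) ⟩
  1 ∎
  where
  open ≡-Reasoning
  E : ∀ {m} → Subset m → ℕ
  E b = indicator (isEmpty? b)
  same : ∀ b → E (outside Vec.∷ b) ≡ E b
  same b = indicator-cong (isEmpty? (outside Vec.∷ b)) (isEmpty? b) drop-∷-Empty Empty-outside
  nonempty : ∀ b → E (inside Vec.∷ b) ≡ 0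
  nonempty b = indicator-no (isEmpty? (inside Vec.∷ b)) (λ empty → empty (zero , Vec.here))

S-∑ : ∀ n k → S n k ≡ ∑ (λ P → indicator (isPartition? k P)) (sublists (subsets n))
S-∑ n k = length-filter (isPartition? k) (sublists (subsets n))

-- Sublists of `subsets (suc n)` split into blocks `as` avoiding `zero` and blocks `bs` containing
-- it, and only `bs` of length one can contribute. Summing over that one block `b` gives the
-- partitions with `zero` alone, plus the pairs of a partition of `Fin n` and a block `b` of it to
-- receive `zero`; double counting turns the latter into the factor `suc k`.
S-rec : ∀ n k → S (suc n) (suc k) ≡ suc k * S n (suc k) + S n k
S-rec n k = begin
  S (suc n) (suc k)
    ≡⟨ S-∑ (suc n) (suc k) ⟩
  ∑ I (sublists (map out ss ++ map ins ss))
    ≡⟨ ∑-sublists-++ I (map out ss) (map ins ss) ⟩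
  ∑ (λ as → ∑ (λ bs → I (as ++ bs)) (sublists (map ins ss))) (sublists (map out ss))
    ≡⟨ cong₂ (λ us vs → ∑ (λ as → ∑ (λ bs → I (as ++ bs)) us) vs)
         (sublists-map ins ss) (sublists-map out ss) ⟩
  ∑ (λ as → ∑ (λ bs → I (as ++ bs)) (map (map ins) (sublists ss))) (map (map out) (sublists ss))
    ≡⟨ ∑-map _ (map out) (sublists ss) ⟩
  ∑ (λ as → ∑ (λ bs → I (map out as ++ bs)) (map (map ins) (sublists ss))) (sublists ss)
    ≡⟨ ∑-cong inner (sublists ss) ⟩
  ∑ (λ as → I₀ as + ∑ (λ b → I₁ (b ∷ as)) ss) (sublists ss)
    ≡⟨ ∑-+ I₀ _ (sublists ss) ⟩
  ∑ I₀ (sublists ss) + ∑ (λ as → ∑ (λ b → I₁ (b ∷ as)) ss) (sublists ss)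
    ≡⟨ cong (∑ I₀ (sublists ss) +_) (∑-sublists-insert I₁ I₁-↭ I₁-dup ss) ⟩
  ∑ I₀ (sublists ss) + ∑ (λ P → length P * I₁ P) (sublists ss)
    ≡⟨ cong (∑ I₀ (sublists ss) +_) (∑-cong weight (sublists ss)) ⟩
  ∑ I₀ (sublists ss) + ∑ (λ P → suc k * I₁ P) (sublists ss)
    ≡⟨ cong (∑ I₀ (sublists ss) +_) (∑-*ˡ (suc k) I₁ (sublists ss)) ⟩
  ∑ I₀ (sublists ss) + suc k * ∑ I₁ (sublists ss)
    ≡⟨ cong₂ (λ u v → u + suc k * v) (S-∑ n k) (S-∑ n (suc k)) ⟨
  S n k + suc k * S n (suc k)
    ≡⟨ +-comm (S n k) _ ⟩
  suc k * S n (suc k) + S n k ∎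
  where
  open ≡-Reasoning
  ss = subsets n
  out ins : Subset n → Subset (suc n)
  out = outside Vec.∷_
  ins = inside Vec.∷_
  I  = λ P → indicator (isPartition? {suc n} (suc k) P)
  I₀ = λ P → indicator (isPartition? {n} k P)
  I₁ = λ P → indicator (isPartition? {n} (suc k) P)

  I₁-↭ : ∀ {xs ys} → xs ↭ ys → I₁ xs ≡ I₁ ys
  I₁-↭ {xs} {ys} xs↭ys = indicator-cong (isPartition? (suc k) xs) (isPartition? (suc k) ys)
    (IsPartition-resp-↭ xs↭ys) (IsPartition-resp-↭ (↭-sym xs↭ys))

  I₁-dup : ∀ x xs → I₁ (x ∷ x ∷ xs) ≡ 0
  I₁-dup x xs = indicator-no (isPartition? (suc k) (x ∷ x ∷ xs))
    λ { (_ , (y , y∈x) ∷ _ , (x∩x=∅ ∷ _) ∷ _ , _) → x∩x=∅ (y , x∈p∩q⁺ (y∈x , y∈x)) }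

  weight : ∀ P → length P * I₁ P ≡ suc k * I₁ P
  weight P = indicator-weight (isPartition? (suc k) P) proj₁

  no-zero : ∀ as → I (map out as ++ []) ≡ 0
  no-zero as = indicator-no (isPartition? (suc k) (map out as ++ [])) λ (_ , _ , _ , cover) →
    uncovered as (cover zero)
    where
    uncovered : ∀ as → ¬ Any (zero ∈_) (map out as ++ [])
    uncovered (_ ∷ as) (there any) = uncovered as any

  two-zeros : ∀ as b b′ bs → I (map out as ++ map ins (b ∷ b′ ∷ bs)) ≡ 0
  two-zeros as b b′ bs = indicator-no (isPartition? (suc k) (map out as ++ map ins (b ∷ b′ ∷ bs)))
    λ isP → not-disjoint (IsPartition-resp-↭ (++-comm (map out as) _) isP)
    where
    not-disjoint : ¬ IsPartition (suc k) (map ins (b ∷ b′ ∷ bs) ++ map out as)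
    not-disjoint (_ , _ , (b∩b′=∅ ∷ _) ∷ _ , _) = b∩b′=∅ (zero , Vec.here)

  one-zero : ∀ as b → I (map out as ++ [ ins b ]) ≡ indicator (isEmpty? b) * I₀ as + I₁ (b ∷ as)
  one-zero as b = begin
    I (map out as ++ [ ins b ])
      ≡⟨ indicator-cong (isPartition? (suc k) (map out as ++ [ ins b ]))
           (isPartition? (suc k) (ins b ∷ map out as))
           (IsPartition-resp-↭ (++-comm (map out as) _))
           (IsPartition-resp-↭ (++-comm [ ins b ] (map out as))) ⟩
    I (ins b ∷ map out as)
      ≡⟨ indicator-⊎ (isPartition? (suc k) (ins b ∷ map out as))
           (isEmpty? b ×-dec isPartition? k as) (isPartition? (suc k) (b ∷ as))
           (drop-zero b as) (add-singleton b as) (add-to-block b as)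
           (λ { (b=∅ , _) (_ , b≠∅ ∷ _ , _) → b=∅ b≠∅ }) ⟩
    indicator (isEmpty? b ×-dec isPartition? k as) + I₁ (b ∷ as)
      ≡⟨ cong (_+ I₁ (b ∷ as)) (indicator-× (isEmpty? b) (isPartition? k as)) ⟩
    indicator (isEmpty? b) * I₀ as + I₁ (b ∷ as) ∎

  inner : ∀ as → ∑ (λ bs → I (map out as ++ bs)) (map (map ins) (sublists ss))
               ≡ I₀ as + ∑ (λ b → I₁ (b ∷ as)) ss
  inner as = begin
    ∑ (λ bs → I (map out as ++ bs)) (map (map ins) (sublists ss))
      ≡⟨ ∑-map _ (map ins) (sublists ss) ⟩
    ∑ (λ bs → I (map out as ++ map ins bs)) (sublists ss)
      ≡⟨ ∑-sublists-singletons _ (no-zero as) (two-zeros as) ss ⟩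
    ∑ (λ b → I (map out as ++ [ ins b ])) ss
      ≡⟨ ∑-cong (one-zero as) ss ⟩
    ∑ (λ b → indicator (isEmpty? b) * I₀ as + I₁ (b ∷ as)) ss
      ≡⟨ ∑-+ _ _ ss ⟩
    ∑ (λ b → indicator (isEmpty? b) * I₀ as) ss + ∑ (λ b → I₁ (b ∷ as)) ss
      ≡⟨ cong (_+ ∑ (λ b → I₁ (b ∷ as)) ss)
           (trans (∑-*ʳ _ (I₀ as) ss) (cong (_* I₀ as) (count-empty n))) ⟩
    1 * I₀ as + ∑ (λ b → I₁ (b ∷ as)) ss
      ≡⟨ cong (_+ ∑ (λ b → I₁ (b ∷ as)) ss) (*-identityˡ (I₀ as)) ⟩
    I₀ as + ∑ (λ b → I₁ (b ∷ as)) ss ∎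

S-suc-zero : ∀ n → S (suc n) 0 ≡ 0
S-suc-zero n = trans (S-∑ (suc n) 0) (∑-zero _ none (sublists (subsets (suc n))))
  where
  none : ∀ P → indicator (isPartition? {suc n} 0 P) ≡ 0
  none P = indicator-no (isPartition? 0 P) (empty P)
    where
    empty : ∀ P → ¬ IsPartition {suc n} 0 P
    empty [] (_ , _ , _ , cover) with () ← cover zero

S-zero-suc : ∀ k → S 0 (suc k) ≡ 0
S-zero-suc k = trans (S-∑ 0 (suc k)) (cong (_+ 0)
  (indicator-no (isPartition? (suc k) (Vec.[] ∷ [])) λ { (_ , (() , _) ∷ _ , _) }))

-- Binary digit sums

digitSum : Expansion 2 → ℕ
digitSum ds = sum (map toℕ ds)

-- Expansions of one number differ only by zeros at the most significant end. Hence any expansion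
-- computes `s₂`, whatever digits `toDigits` returns.
digitSum-unique : ∀ ds es → fromDigits ds ≡ fromDigits es → digitSum ds ≡ digitSum es
digitSum-unique []              []              eq = refl
digitSum-unique []              (zero ∷ es)     eq = digitSum-unique [] es (*-cancelʳ-≡ 0 _ 2 eq)
digitSum-unique (zero ∷ ds)     []              eq = digitSum-unique ds [] (*-cancelʳ-≡ _ 0 2 eq)
digitSum-unique (zero ∷ ds)     (zero ∷ es)     eq = digitSum-unique ds es (*-cancelʳ-≡ _ _ 2 eq)
digitSum-unique (suc zero ∷ ds) (suc zero ∷ es) eq =
  cong suc (digitSum-unique ds es (*-cancelʳ-≡ _ _ 2 (suc-injective eq)))
digitSum-unique (zero ∷ ds)     (suc zero ∷ es) eq =
  contradiction (trans (*-comm 2 (fromDigits ds)) (trans eq (cong suc (*-comm (fromDigits es) 2))))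
    (even≢odd (fromDigits ds) (fromDigits es))
digitSum-unique (suc zero ∷ ds) (zero ∷ es)     eq =
  sym (digitSum-unique (zero ∷ es) (suc zero ∷ ds) (sym eq))

s₂-fromDigits : ∀ ds → s₂ (fromDigits ds) ≡ digitSum ds
s₂-fromDigits ds = digitSum-unique (proj₁ (toDigits 2 (fromDigits ds))) ds (proj₂ (toDigits 2 (fromDigits ds)))

s₂-cons : ∀ (d : Fin 2) n → s₂ (toℕ d + 2 * n) ≡ toℕ d + s₂ n
s₂-cons d n = trans (cong (λ m → s₂ (toℕ d + m)) eq) (s₂-fromDigits (d ∷ proj₁ (toDigits 2 n)))
  where
  eq : 2 * n ≡ fromDigits (proj₁ (toDigits 2 n)) * 2
  eq = trans (*-comm 2 n) (cong (_* 2) (sym (proj₂ (toDigits 2 n))))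

s₂-double : ∀ n → s₂ (2 * n) ≡ s₂ n
s₂-double = s₂-cons zero

s₂-suc-double : ∀ n → s₂ (suc (2 * n)) ≡ suc (s₂ n)
s₂-suc-double = s₂-cons (suc zero)

data Halved : ℕ → Set where
  even : ∀ m → Halved (2 * m)
  odd  : ∀ m → Halved (suc (2 * m))

halve : ∀ n → Halved n
halve zero = even 0
halve (suc n) with halve n
... | even m = odd m
... | odd  m = subst Halved (*-suc 2 m) (even (suc m))

m<2*m : ∀ m → m < suc (2 * m)
m<2*m m = s≤s (m≤m+n m _)

-- Stated with a predecessor so that matching on it makes `s₂ (suc n) ∸ 1` an honest subtraction.
s₂-suc≢0 : ∀ n → ∃ λ r → s₂ (suc n) ≡ suc r
s₂-suc≢0 = <-rec _ go
  where
  go : ∀ n → (∀ {m} → m < n → ∃ λ r → s₂ (suc m) ≡ suc r) → ∃ λ r → s₂ (suc n) ≡ suc r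
  go n rec with halve n
  ... | even m = s₂ m , s₂-suc-double m
  ... | odd m with r , eq ← rec (m<2*m m) = r , (begin
    s₂ (2 + 2 * m)   ≡⟨ cong s₂ (*-suc 2 m) ⟨
    s₂ (2 * suc m)   ≡⟨ s₂-double (suc m) ⟩
    s₂ (suc m)       ≡⟨ eq ⟩
    suc r            ∎)
    where open ≡-Reasoning

-- The digits of `b` lie below position n and those of `c * 2 ^ n` at or above it; the induction on
-- `n` strips the lowest digit of `b`.
s₂-shift : ∀ n c b → b < 2 ^ n → s₂ (c * 2 ^ n + b) ≡ s₂ c + s₂ b
s₂-shift zero    c zero    _ =
  trans (cong s₂ (trans (+-identityʳ (c * 1)) (*-identityʳ c))) (sym (+-identityʳ (s₂ c)))
s₂-shift zero    c (suc b) (s≤s ())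
s₂-shift (suc n) c b b<2ⁿ with halve b
... | even m = begin
  s₂ (c * (2 * 2 ^ n) + 2 * m)   ≡⟨ cong s₂ (shuffle c (2 ^ n) m) ⟩
  s₂ (2 * (c * 2 ^ n + m))       ≡⟨ s₂-double (c * 2 ^ n + m) ⟩
  s₂ (c * 2 ^ n + m)             ≡⟨ s₂-shift n c m (*-cancelˡ-< 2 m (2 ^ n) b<2ⁿ) ⟩
  s₂ c + s₂ m                    ≡⟨ cong (s₂ c +_) (s₂-double m) ⟨
  s₂ c + s₂ (2 * m)              ∎
  where
  open ≡-Reasoning
  shuffle : ∀ c p m → c * (2 * p) + 2 * m ≡ 2 * (c * p + m)
  shuffle = solve-∀
... | odd m = begin
  s₂ (c * (2 * 2 ^ n) + suc (2 * m))   ≡⟨ cong s₂ (shuffle c (2 ^ n) m) ⟩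
  s₂ (suc (2 * (c * 2 ^ n + m)))       ≡⟨ s₂-suc-double (c * 2 ^ n + m) ⟩
  suc (s₂ (c * 2 ^ n + m))             ≡⟨ cong suc (s₂-shift n c m m<2ⁿ) ⟩
  suc (s₂ c + s₂ m)                    ≡⟨ +-suc (s₂ c) (s₂ m) ⟨
  s₂ c + suc (s₂ m)                    ≡⟨ cong (s₂ c +_) (s₂-suc-double m) ⟨
  s₂ c + s₂ (suc (2 * m))              ∎
  where
  open ≡-Reasoning
  m<2ⁿ : m < 2 ^ n
  m<2ⁿ = *-cancelˡ-< 2 m (2 ^ n) (<-trans (n<1+n (2 * m)) b<2ⁿ)
  shuffle : ∀ c p m → c * (2 * p) + suc (2 * m) ≡ suc (2 * (c * p + m))
  shuffle = solve-∀

s₂-*2^ : ∀ n c → s₂ (c * 2 ^ n) ≡ s₂ c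
s₂-*2^ n c = begin
  s₂ (c * 2 ^ n)       ≡⟨ cong s₂ (+-identityʳ (c * 2 ^ n)) ⟨
  s₂ (c * 2 ^ n + 0)   ≡⟨ s₂-shift n c 0 (m^n>0 2 n) ⟩
  s₂ c + 0             ≡⟨ +-identityʳ (s₂ c) ⟩
  s₂ c                 ∎
  where open ≡-Reasoning

-- Powers of two and odd cofactors

Odd : ℕ → Set
Odd n = parity n ≡ 1ℙ

parity-double : ∀ n → parity (2 * n) ≡ 0ℙ
parity-double n = *-homo-* 2 n

Odd-suc-double : ∀ n → Odd (suc (2 * n))
Odd-suc-double n = trans (+-homo-+ 1 (2 * n)) (cong (1ℙ ℙ.+_) (parity-double n))

Odd-* : ∀ m n → Odd m → Odd n → Odd (m * n)
Odd-* m n m-odd n-odd = trans (*-homo-* m n) (cong₂ ℙ._*_ m-odd n-odd)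

Odd-*⁻ˡ : ∀ m n → Odd (m * n) → Odd m
Odd-*⁻ˡ m n mn-odd with parity m | *-homo-* m n
... | 1ℙ | _ = refl
... | 0ℙ | eq with () ← trans (sym mn-odd) eq

-- Replaces division by the unit `o`: while a factor 2 remains on the right, `x` cannot be odd, so
-- the powers of 2 can be moved out of `x` one at a time.
cancel-odd : ∀ e x y o → Odd o → x * o ≡ 2 ^ e * y → ∃ λ z → x ≡ 2 ^ e * z × z * o ≡ y
cancel-odd zero    x y o o-odd eq = x , sym (*-identityˡ x) , trans eq (*-identityˡ y)
cancel-odd (suc e) x y o o-odd eq with halve x
... | odd m with () ← trans (sym (Odd-* (suc (2 * m)) o (Odd-suc-double m) o-odd))
      (trans (cong parity (trans eq (*-assoc 2 (2 ^ e) y))) (parity-double (2 ^ e * y)))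
... | even m with z , m≡ , zo≡y ← cancel-odd e m y o o-odd
      (*-cancelˡ-≡ _ _ 2 (trans (sym (*-assoc 2 m o)) (trans eq (*-assoc 2 (2 ^ e) y))))
    = z , trans (cong (2 *_) m≡) (sym (*-assoc 2 (2 ^ e) z)) , zo≡y

2^∣2^*odd : ∀ j v z → Odd z → 2 ^ j ∣ 2 ^ v * z → j ≤ v
2^∣2^*odd zero    v       z z-odd _ = z≤n
2^∣2^*odd (suc j) zero    z z-odd (divides q eq)
  with () ← trans (sym z-odd) (trans
    (cong parity (trans (sym (*-identityˡ z)) (trans eq (x∙yz≈y∙xz *-commutativeSemigroup q 2 (2 ^ j)))))
    (parity-double (q * 2 ^ j)))
2^∣2^*odd (suc j) (suc v) z z-odd d =
  s≤s (2^∣2^*odd j v z z-odd (*-cancelˡ-∣ 2 (subst (2 ^ suc j ∣_) (*-assoc 2 (2 ^ v) z) d)))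

ν₂-2^*odd : ∀ {m} v z → Odd z → m ≡ 2 ^ v * z → ν₂[ m ]≡ v
ν₂-2^*odd v z z-odd refl = m∣m*n z , λ j → 2^∣2^*odd j v z z-odd

-- The theorems of Legendre and Kummer at the prime 2

-- Adding 1 clears the r trailing ones of `n` and sets one new digit, and 2^r divides `suc n`
-- exactly. So ν₂(n + 1) = s₂(n) + 1 - s₂(n + 1), written without subtraction.
s₂-suc : ∀ n → ∃ λ o → Odd o × 2 ^ s₂ (suc n) * suc n ≡ 2 ^ s₂ n * (2 * o)
s₂-suc = <-rec _ go
  where
  open ≡-Reasoning
  go : ∀ n → (∀ {m} → m < n → ∃ λ o → Odd o × 2 ^ s₂ (suc m) * suc m ≡ 2 ^ s₂ m * (2 * o)) →
    ∃ λ o → Odd o × 2 ^ s₂ (suc n) * suc n ≡ 2 ^ s₂ n * (2 * o)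
  go n rec with halve n
  ... | even m = suc (2 * m) , Odd-suc-double m , (begin
    2 ^ s₂ (suc (2 * m)) * suc (2 * m)    ≡⟨ cong (λ e → 2 ^ e * suc (2 * m)) (s₂-suc-double m) ⟩
    2 ^ suc (s₂ m) * suc (2 * m)          ≡⟨ shuffle (2 ^ s₂ m) (suc (2 * m)) ⟩
    2 ^ s₂ m * (2 * suc (2 * m))          ≡⟨ cong (λ e → 2 ^ e * (2 * suc (2 * m))) (s₂-double m) ⟨
    2 ^ s₂ (2 * m) * (2 * suc (2 * m))    ∎)
    where
    shuffle : ∀ p q → 2 * p * q ≡ p * (2 * q)
    shuffle = solve-∀
  ... | odd m with o , o-odd , eq ← rec (m<2*m m) = o , o-odd , (begin
    2 ^ s₂ (2 + 2 * m) * (2 + 2 * m)          ≡⟨ cong (λ l → 2 ^ s₂ l * l) (*-suc 2 m) ⟨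
    2 ^ s₂ (2 * suc m) * (2 * suc m)          ≡⟨ cong (λ e → 2 ^ e * (2 * suc m)) (s₂-double (suc m)) ⟩
    2 ^ s₂ (suc m) * (2 * suc m)              ≡⟨ shuffle (2 ^ s₂ (suc m)) (suc m) ⟩
    2 * (2 ^ s₂ (suc m) * suc m)              ≡⟨ cong (2 *_) eq ⟩
    2 * (2 ^ s₂ m * (2 * o))                  ≡⟨ *-assoc 2 (2 ^ s₂ m) (2 * o) ⟨
    2 ^ suc (s₂ m) * (2 * o)                  ≡⟨ cong (λ e → 2 ^ e * (2 * o)) (s₂-suc-double m) ⟨
    2 ^ s₂ (suc (2 * m)) * (2 * o)            ∎)
    where
    shuffle : ∀ p q → p * (2 * q) ≡ 2 * (p * q)
    shuffle = solve-∀

-- The product of the identities `s₂-suc` telescopes to ν₂(n!) = n - s₂(n), with `o` the odd part of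
-- n!.
legendre : ∀ n → ∃ λ o → Odd o × 2 ^ s₂ n * n ! ≡ 2 ^ n * o
legendre zero = 1 , refl , refl
legendre (suc n) with o , o-odd , eq ← legendre n | o′ , o′-odd , eq′ ← s₂-suc n =
  o′ * o , Odd-* o′ o o′-odd o-odd , (begin
  2 ^ s₂ (suc n) * (suc n * n !)    ≡⟨ *-assoc (2 ^ s₂ (suc n)) (suc n) (n !) ⟨
  2 ^ s₂ (suc n) * suc n * n !      ≡⟨ cong (_* n !) eq′ ⟩
  2 ^ s₂ n * (2 * o′) * n !         ≡⟨ shuffle₁ (2 ^ s₂ n) o′ (n !) ⟩
  2 * o′ * (2 ^ s₂ n * n !)         ≡⟨ cong (2 * o′ *_) eq ⟩
  2 * o′ * (2 ^ n * o)              ≡⟨ shuffle₂ o′ (2 ^ n) o ⟩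
  2 ^ suc n * (o′ * o)              ∎)
  where
  open ≡-Reasoning
  shuffle₁ : ∀ p o f → p * (2 * o) * f ≡ 2 * o * (p * f)
  shuffle₁ = solve-∀
  shuffle₂ : ∀ o′ p o → 2 * o′ * (p * o) ≡ 2 * p * (o′ * o)
  shuffle₂ = solve-∀

-- Indexed by the two parts of i + j, as convolutions use it; this also frees Pascal's rule from
-- truncated subtraction.
binom : ℕ → ℕ → ℕ
binom i j = (i + j) C i

binom-! : ∀ i j → binom i j * (i ! * j !) ≡ (i + j) !
binom-! i j = subst (λ l → binom i j * (i ! * l !) ≡ (i + j) !) (m+n∸m≡n i j)
  (trans (cong (_* (i ! * (i + j ∸ i) !)) (nCk≡n!/k![n-k]! i≤i+j))
    (m/n*n≡m {{i !* (i + j ∸ i) !≢0}} (k![n∸k]!∣n! i≤i+j)))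
  where i≤i+j = m≤m+n i j

binom-zeroʳ : ∀ i → binom i 0 ≡ 1
binom-zeroʳ i = trans (nCk≡nC[n∸k] (m≤m+n i 0)) (cong ((i + 0) C_) (m+n∸m≡n i 0))

binom-pascal : ∀ i j → binom (suc i) (suc j) ≡ binom i (suc j) + binom (suc i) j
binom-pascal i j = trans (sym (nCk+nC[k+1]≡[n+1]C[k+1] (i + suc j) i))
  (cong (λ l → binom i (suc j) + l C suc i) (+-suc i j))

binom-sym : ∀ i j → binom i j ≡ binom j i
binom-sym i j = trans (nCk≡nC[n∸k] (m≤m+n i j)) (cong₂ _C_ (+-comm i j) (m+n∸m≡n i j))

-- The quotient of Legendre's formulas for i + j, i and j. The odd cofactor is returned because it
-- enters the definition of `weight`.
kummer : ∀ i j → ∃ λ q → Odd q × 2 ^ s₂ (i + j) * binom i j ≡ 2 ^ (s₂ i + s₂ j) * q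
kummer i j
  with oᵢ , oᵢ-odd , eqᵢ ← legendre i
     | oⱼ , oⱼ-odd , eqⱼ ← legendre j
     | o , o-odd , eq ← legendre (i + j)
  = let q , eq-q , q*≡o = cancel-odd (s₂ i + s₂ j) (2 ^ s₂ (i + j) * binom i j) o (oᵢ * oⱼ)
                            (Odd-* oᵢ oⱼ oᵢ-odd oⱼ-odd) (*-cancelˡ-≡ _ _ (2 ^ (i + j)) {{m^n≢0 2 (i + j)}} scaled)
    in q , Odd-*⁻ˡ q (oᵢ * oⱼ) (trans (cong parity q*≡o) o-odd) , eq-q
  where
  open ≡-Reasoning
  shuffle₁ : ∀ a b s c x y → a * b * (s * c * (x * y)) ≡ s * c * (a * x * (b * y))
  shuffle₁ = solve-∀
  shuffle₂ : ∀ s c p x q y → s * c * (p * x * (q * y)) ≡ p * q * (s * (c * (x * y)))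
  shuffle₂ = solve-∀
  scaled : 2 ^ (i + j) * (2 ^ s₂ (i + j) * binom i j * (oᵢ * oⱼ))
         ≡ 2 ^ (i + j) * (2 ^ (s₂ i + s₂ j) * o)
  scaled = begin
    2 ^ (i + j) * (2 ^ s₂ (i + j) * binom i j * (oᵢ * oⱼ))
      ≡⟨ cong (_* (2 ^ s₂ (i + j) * binom i j * (oᵢ * oⱼ))) (^-distribˡ-+-* 2 i j) ⟩
    2 ^ i * 2 ^ j * (2 ^ s₂ (i + j) * binom i j * (oᵢ * oⱼ))
      ≡⟨ shuffle₁ (2 ^ i) (2 ^ j) (2 ^ s₂ (i + j)) (binom i j) oᵢ oⱼ ⟩
    2 ^ s₂ (i + j) * binom i j * (2 ^ i * oᵢ * (2 ^ j * oⱼ))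
      ≡⟨ cong₂ (λ u v → 2 ^ s₂ (i + j) * binom i j * (u * v)) eqᵢ eqⱼ ⟨
    2 ^ s₂ (i + j) * binom i j * (2 ^ s₂ i * i ! * (2 ^ s₂ j * j !))
      ≡⟨ shuffle₂ (2 ^ s₂ (i + j)) (binom i j) (2 ^ s₂ i) (i !) (2 ^ s₂ j) (j !) ⟩
    2 ^ s₂ i * 2 ^ s₂ j * (2 ^ s₂ (i + j) * (binom i j * (i ! * j !)))
      ≡⟨ cong₂ _*_ (^-distribˡ-+-* 2 (s₂ i) (s₂ j)) (cong (2 ^ s₂ (i + j) *_) (sym (binom-! i j))) ⟨
    2 ^ (s₂ i + s₂ j) * (2 ^ s₂ (i + j) * (i + j) !)
      ≡⟨ cong (2 ^ (s₂ i + s₂ j) *_) eq ⟩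
    2 ^ (s₂ i + s₂ j) * (2 ^ (i + j) * o)
      ≡⟨ x∙yz≈y∙xz *-commutativeSemigroup (2 ^ (s₂ i + s₂ j)) (2 ^ (i + j)) o ⟩
    2 ^ (i + j) * (2 ^ (s₂ i + s₂ j) * o) ∎

-- Sums over antidiagonals

-- The n-th coefficient of a product of series, with summands that may depend on both indices, as
-- binomial coefficients do.
antidiagonal : (ℕ → ℕ → ℕ) → ℕ → ℕ
antidiagonal f zero    = f 0 0
antidiagonal f (suc n) = f 0 (suc n) + antidiagonal (λ i j → f (suc i) j) n

antidiagonal-cong : ∀ {f g} n → (∀ i j → i + j ≡ n → f i j ≡ g i j) →
  antidiagonal f n ≡ antidiagonal g n
antidiagonal-cong zero    f≡g = f≡g 0 0 refl
antidiagonal-cong (suc n) f≡g =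
  cong₂ _+_ (f≡g 0 (suc n) refl) (antidiagonal-cong n (λ i j eq → f≡g (suc i) j (cong suc eq)))

antidiagonal-parity : ∀ {f g} n → (∀ i j → parity (f i j) ≡ parity (g i j)) →
  parity (antidiagonal f n) ≡ parity (antidiagonal g n)
antidiagonal-parity zero f≡g = f≡g 0 0
antidiagonal-parity {f} {g} (suc n) f≡g = begin
  parity (antidiagonal f (suc n))
    ≡⟨ +-homo-+ (f 0 (suc n)) _ ⟩
  parity (f 0 (suc n)) ℙ.+ parity (antidiagonal (λ i j → f (suc i) j) n)
    ≡⟨ cong₂ ℙ._+_ (f≡g 0 (suc n)) (antidiagonal-parity n (λ i → f≡g (suc i))) ⟩
  parity (g 0 (suc n)) ℙ.+ parity (antidiagonal (λ i j → g (suc i) j) n)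
    ≡⟨ +-homo-+ (g 0 (suc n)) _ ⟨
  parity (antidiagonal g (suc n)) ∎
  where open ≡-Reasoning

antidiagonal-+ : ∀ f g n →
  antidiagonal (λ i j → f i j + g i j) n ≡ antidiagonal f n + antidiagonal g n
antidiagonal-+ f g zero    = refl
antidiagonal-+ f g (suc n) =
  trans (cong (f 0 (suc n) + g 0 (suc n) +_) (antidiagonal-+ _ _ n)) (shuffle (f 0 (suc n)) _ _ _)
  where
  shuffle : ∀ a b c d → a + b + (c + d) ≡ a + c + (b + d)
  shuffle = solve-∀

antidiagonal-* : ∀ c f n → antidiagonal (λ i j → c * f i j) n ≡ c * antidiagonal f n
antidiagonal-* c f zero    = refl
antidiagonal-* c f (suc n) =
  trans (cong (c * f 0 (suc n) +_) (antidiagonal-* c _ n)) (sym (*-distribˡ-+ c (f 0 (suc n)) _))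

antidiagonal-zero : ∀ n → antidiagonal (λ _ _ → 0) n ≡ 0
antidiagonal-zero zero    = refl
antidiagonal-zero (suc n) = antidiagonal-zero n

antidiagonal-last : ∀ f n →
  antidiagonal f (suc n) ≡ antidiagonal (λ i j → f i (suc j)) n + f (suc n) 0
antidiagonal-last f zero    = refl
antidiagonal-last f (suc n) =
  trans (cong (f 0 (2 + n) +_) (antidiagonal-last (λ i → f (suc i)) n)) (sym (+-assoc (f 0 (2 + n)) _ _))

-- Surjections

binomialTransform : (ℕ → ℕ) → ℕ → ℕ
binomialTransform w = antidiagonal (λ i j → binom i j * w j)

-- `binomialTransform` multiplies exponential generating functions by eᵗ, and a shift of the
-- sequence is a derivative: this is (eᵗW)′ = eᵗW + eᵗW′.
binomialTransform-suc : ∀ w n →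
  binomialTransform w (suc n) ≡ binomialTransform w n + binomialTransform (λ j → w (suc j)) n
binomialTransform-suc w n = begin
  binomialTransform w (suc n)
    ≡⟨ antidiagonal-cong (suc n) pascal ⟩
  antidiagonal (λ i j → f i j + g i j) (suc n)
    ≡⟨ antidiagonal-+ f g (suc n) ⟩
  antidiagonal f (suc n) + antidiagonal g (suc n)
    ≡⟨ cong (antidiagonal f (suc n) +_) (trans (antidiagonal-last g n) (+-identityʳ _)) ⟩
  binomialTransform w n + binomialTransform (λ j → w (suc j)) n ∎
  where
  open ≡-Reasoning
  f g : ℕ → ℕ → ℕ
  -- Pascal's rule with its boundary cases: `f` is padded with zeros at i = 0 and `g` at j = 0.
  f zero    j = 0
  f (suc i) j = binom i j * w j
  g i zero    = 0
  g i (suc j) = binom i j * w (suc j)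
  pascal : ∀ i j → i + j ≡ suc n → binom i j * w j ≡ f i j + g i j
  pascal zero    (suc j) _ = refl
  pascal (suc i) zero    _ = trans
    (cong (_* w 0) (trans (binom-zeroʳ (suc i)) (sym (binom-zeroʳ i)))) (sym (+-identityʳ _))
  pascal (suc i) (suc j) _ = begin
    binom (suc i) (suc j) * w (suc j)
      ≡⟨ cong (_* w (suc j)) (binom-pascal i j) ⟩
    (binom i (suc j) + binom (suc i) j) * w (suc j)
      ≡⟨ *-distribʳ-+ (w (suc j)) (binom i (suc j)) _ ⟩
    binom i (suc j) * w (suc j) + binom (suc i) j * w (suc j) ∎

binomialTransform-linear : ∀ c u v n → binomialTransform (λ j → c * (u j + v j)) n
  ≡ c * (binomialTransform u n + binomialTransform v n)
binomialTransform-linear c u v n = begin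
  binomialTransform (λ j → c * (u j + v j)) n
    ≡⟨ antidiagonal-cong n (λ i j _ → shuffle (binom i j) c (u j) (v j)) ⟩
  antidiagonal (λ i j → c * (binom i j * u j + binom i j * v j)) n
    ≡⟨ antidiagonal-* c _ n ⟩
  c * antidiagonal (λ i j → binom i j * u j + binom i j * v j) n
    ≡⟨ cong (c *_) (antidiagonal-+ _ _ n) ⟩
  c * (binomialTransform u n + binomialTransform v n) ∎
  where
  open ≡-Reasoning
  shuffle : ∀ b c u v → b * (c * (u + v)) ≡ c * (b * u + b * v)
  shuffle = solve-∀

surj : ℕ → ℕ → ℕ
surj n k = k ! * S n k

surj-suc-zero : ∀ n → surj (suc n) 0 ≡ 0
surj-suc-zero n = cong (1 *_) (S-suc-zero n)

surj-zero-suc : ∀ k → surj 0 (suc k) ≡ 0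
surj-zero-suc k = trans (cong (suc k ! *_) (S-zero-suc k)) (*-zeroʳ (suc k !))

surj-rec : ∀ n k → surj (suc n) (suc k) ≡ suc k * (surj n (suc k) + surj n k)
surj-rec n k = trans (cong (suc k ! *_) (S-rec n k)) (shuffle (suc k) (k !) (S n (suc k)) (S n k))
  where
  shuffle : ∀ k f a b → k * f * (k * a + b) ≡ k * (k * f * a + f * b)
  shuffle = solve-∀

-- In generating functions, eᵗ(eᵗ - 1)ᵏ = (eᵗ - 1)ᵏ + (eᵗ - 1)ᵏ⁺¹. The induction on `n` compares
-- derivatives by `surj-rec`.
surj-binomialTransform : ∀ n k →
  binomialTransform (λ j → surj j k) n ≡ surj n k + surj n (suc k)
surj-binomialTransform zero k =
  trans (+-identityʳ (surj 0 k)) (sym (trans (cong (surj 0 k +_) (surj-zero-suc k)) (+-identityʳ _)))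
surj-binomialTransform (suc n) zero = begin
  binomialTransform (λ j → surj j 0) (suc n)
    ≡⟨ binomialTransform-suc (λ j → surj j 0) n ⟩
  binomialTransform (λ j → surj j 0) n + binomialTransform (λ j → surj (suc j) 0) n
    ≡⟨ cong₂ _+_ (surj-binomialTransform n 0) (trans (antidiagonal-cong n vanish) (antidiagonal-zero n)) ⟩
  surj n 0 + surj n 1 + 0
    ≡⟨ shuffle (surj n 0) (surj n 1) ⟩
  0 + 1 * (surj n 1 + surj n 0)
    ≡⟨ cong₂ _+_ (surj-suc-zero n) (surj-rec n 0) ⟨
  surj (suc n) 0 + surj (suc n) 1 ∎
  where
  open ≡-Reasoning
  vanish : ∀ i j → i + j ≡ n → binom i j * surj (suc j) 0 ≡ 0
  vanish i j _ = trans (cong (binom i j *_) (surj-suc-zero j)) (*-zeroʳ (binom i j))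
  shuffle : ∀ a b → a + b + 0 ≡ 0 + 1 * (b + a)
  shuffle = solve-∀
surj-binomialTransform (suc n) (suc k) = begin
  binomialTransform (λ j → surj j (suc k)) (suc n)
    ≡⟨ binomialTransform-suc (λ j → surj j (suc k)) n ⟩
  binomialTransform (λ j → surj j (suc k)) n + binomialTransform (λ j → surj (suc j) (suc k)) n
    ≡⟨ cong (binomialTransform (λ j → surj j (suc k)) n +_)
         (antidiagonal-cong n (λ i j _ → cong (binom i j *_) (surj-rec j k))) ⟩
  binomialTransform (λ j → surj j (suc k)) n
    + binomialTransform (λ j → suc k * (surj j (suc k) + surj j k)) n
    ≡⟨ cong (binomialTransform (λ j → surj j (suc k)) n +_)
         (binomialTransform-linear (suc k) (λ j → surj j (suc k)) (λ j → surj j k) n) ⟩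
  binomialTransform (λ j → surj j (suc k)) n
    + suc k * (binomialTransform (λ j → surj j (suc k)) n + binomialTransform (λ j → surj j k) n)
    ≡⟨ cong₂ (λ u v → u + suc k * (u + v))
         (surj-binomialTransform n (suc k)) (surj-binomialTransform n k) ⟩
  (b + c) + suc k * ((b + c) + (a + b))
    ≡⟨ shuffle k a b c ⟩
  suc k * (b + a) + suc (suc k) * (c + b)
    ≡⟨ cong₂ _+_ (surj-rec n k) (surj-rec n (suc k)) ⟨
  surj (suc n) (suc k) + surj (suc n) (suc (suc k)) ∎
  where
  open ≡-Reasoning
  a = surj n k
  b = surj n (suc k)
  c = surj n (2 + k)
  shuffle : ∀ k a b c → b + c + (1 + k) * (b + c + (a + b)) ≡ (1 + k) * (b + a) + (2 + k) * (c + b)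
  shuffle = solve-∀

-- Dropping i = 0 replaces the factor eᵗ by eᵗ - 1.
binom⁺ : ℕ → ℕ → ℕ
binom⁺ zero    j = 0
binom⁺ (suc i) j = binom (suc i) j

surj-convolution : ∀ n k → surj n (suc k) ≡ antidiagonal (λ i j → binom⁺ i j * surj j k) n
surj-convolution n k = +-cancelˡ-≡ (surj n k) _ _
  (trans (sym (surj-binomialTransform n k)) (split n))
  where
  split : ∀ n → binomialTransform (λ j → surj j k) n
    ≡ surj n k + antidiagonal (λ i j → binom⁺ i j * surj j k) n
  split zero    = refl
  split (suc n) = cong (_+ antidiagonal (λ i j → binom (suc i) j * surj j k) n) (*-identityˡ (surj (suc n) k))

-- Surjection numbers without their powers of 2

-- For i ≥ 1 both are odd exactly when s₂ i = 1, that is, when i is a power of 2.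
weight weight₂ : ℕ → ℕ → ℕ
weight zero    j = 0
weight (suc i) j = 2 ^ (s₂ (suc i) ∸ 1) * proj₁ (kummer (suc i) j)
weight₂ zero    j = 0
weight₂ (suc i) j = 2 ^ (s₂ (suc i) ∸ 1)

weight-parity : ∀ i j → parity (weight i j) ≡ parity (weight₂ i j)
weight-parity zero    j = refl
weight-parity (suc i) j = begin
  parity (p * q)            ≡⟨ *-homo-* p q ⟩
  parity p ℙ.* parity q     ≡⟨ cong (parity p ℙ.*_) (proj₁ (proj₂ (kummer (suc i) j))) ⟩
  parity p ℙ.* 1ℙ           ≡⟨ ℙ.*-identityʳ (parity p) ⟩
  parity p                  ∎
  where
  open ≡-Reasoning
  p = 2 ^ (s₂ (suc i) ∸ 1)
  q = proj₁ (kummer (suc i) j)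

-- For i ≥ 1 the digit sum of i is at least 1, so Kummer's power of 2 always has a factor 2 to split
-- off. It is the halving in (e^(2u) - 1)/2.
binom⁺-weight : ∀ i j → 2 ^ s₂ (i + j) * binom⁺ i j ≡ 2 * weight i j * 2 ^ s₂ j
binom⁺-weight zero    j = *-zeroʳ (2 ^ s₂ j)
binom⁺-weight (suc i) j =
  trans (proj₂ (proj₂ (kummer (suc i) j))) (split (s₂ (suc i)) (s₂ j) _ (s₂-suc≢0 i))
  where
  open ≡-Reasoning
  shuffle : ∀ a b q → 2 * (a * b) * q ≡ 2 * (a * q) * b
  shuffle = solve-∀
  -- The digit sum is generalised to `s` so that it can be replaced by `suc r`.
  split : ∀ s t q → (∃ λ r → s ≡ suc r) → 2 ^ (s + t) * q ≡ 2 * (2 ^ (s ∸ 1) * q) * 2 ^ t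
  split _ t q (r , refl) = begin
    2 * 2 ^ (r + t) * q            ≡⟨ cong (λ p → 2 * p * q) (^-distribˡ-+-* 2 r t) ⟩
    2 * (2 ^ r * 2 ^ t) * q        ≡⟨ shuffle (2 ^ r) (2 ^ t) q ⟩
    2 * (2 ^ r * q) * 2 ^ t        ∎

-- Up to an odd factor, the coefficient of uⁿ in ((e^(2u) − 1) / 2)^k.
surj′ : ℕ → ℕ → ℕ
surj′ zero    zero    = 1
surj′ zero    (suc n) = 0
surj′ (suc k) n       = antidiagonal (λ i j → weight i j * surj′ k j) n

-- Each convolution step trades `2 ^ s₂ (i + j)` for `2 ^ s₂ j`, which the induction hypothesis
-- absorbs, and releases one factor 2.
surj-surj′ : ∀ k n → 2 ^ s₂ n * surj n k ≡ 2 ^ k * surj′ k n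
surj-surj′ zero    zero    = refl
surj-surj′ zero    (suc n) = trans (cong (2 ^ s₂ (suc n) *_) (surj-suc-zero n)) (*-zeroʳ (2 ^ s₂ (suc n)))
surj-surj′ (suc k) n = begin
  2 ^ s₂ n * surj n (suc k)
    ≡⟨ cong (2 ^ s₂ n *_) (surj-convolution n k) ⟩
  2 ^ s₂ n * antidiagonal (λ i j → binom⁺ i j * surj j k) n
    ≡⟨ antidiagonal-* (2 ^ s₂ n) _ n ⟨
  antidiagonal (λ i j → 2 ^ s₂ n * (binom⁺ i j * surj j k)) n
    ≡⟨ antidiagonal-cong n step ⟩
  antidiagonal (λ i j → 2 ^ suc k * (weight i j * surj′ k j)) n
    ≡⟨ antidiagonal-* (2 ^ suc k) _ n ⟩
  2 ^ suc k * surj′ (suc k) n ∎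
  where
  open ≡-Reasoning
  shuffle : ∀ w p x → 2 * w * (p * x) ≡ 2 * p * (w * x)
  shuffle = solve-∀
  step : ∀ i j → i + j ≡ n → 2 ^ s₂ n * (binom⁺ i j * surj j k) ≡ 2 ^ suc k * (weight i j * surj′ k j)
  step i j refl = begin
    2 ^ s₂ (i + j) * (binom⁺ i j * surj j k)     ≡⟨ *-assoc (2 ^ s₂ (i + j)) (binom⁺ i j) _ ⟨
    2 ^ s₂ (i + j) * binom⁺ i j * surj j k       ≡⟨ cong (_* surj j k) (binom⁺-weight i j) ⟩
    2 * weight i j * 2 ^ s₂ j * surj j k         ≡⟨ *-assoc (2 * weight i j) (2 ^ s₂ j) _ ⟩
    2 * weight i j * (2 ^ s₂ j * surj j k)       ≡⟨ cong (2 * weight i j *_) (surj-surj′ k j) ⟩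
    2 * weight i j * (2 ^ k * surj′ k j)         ≡⟨ shuffle (weight i j) (2 ^ k) (surj′ k j) ⟩
    2 ^ suc k * (weight i j * surj′ k j)         ∎

-- `weight` vanishes at i = 0, so each of the k factors raises the degree by at least one.
surj′-above : ∀ k n → n < k → surj′ k n ≡ 0
surj′-above (suc k) n (s≤s n≤k) = trans (antidiagonal-cong n vanish) (antidiagonal-zero n)
  where
  vanish : ∀ i j → i + j ≡ n → weight i j * surj′ k j ≡ 0
  vanish zero    j _    = refl
  vanish (suc i) j refl = trans
    (cong (weight (suc i) j *_) (surj′-above k j (≤-trans (s≤s (m≤n+m j i)) n≤k)))
    (*-zeroʳ (weight (suc i) j))

-- The quadratic relation and the parity of the reduced surjection numbers

surj-one : ∀ n → surj (suc n) 1 ≡ 1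
surj-one zero    = trans (surj-rec 0 0) (cong (λ a → 1 * (a + surj 0 0)) (surj-zero-suc 0))
surj-one (suc n) = trans (surj-rec (suc n) 0)
  (trans (*-identityˡ _) (cong₂ _+_ (surj-one n) (surj-suc-zero n)))

-- Of the 2ⁿ⁺¹ maps to two points, exactly the two constant ones fail to be onto.
surj-two : ∀ n → surj (suc n) 2 + 2 ≡ 2 ^ suc n
surj-two zero    = cong (_+ 2) (trans (surj-rec 0 1)
  (cong₂ (λ a b → 2 * (a + b)) (surj-zero-suc 1) (surj-zero-suc 0)))
surj-two (suc n) = begin
  surj (2 + n) 2 + 2                            ≡⟨ cong (_+ 2) (surj-rec (suc n) 1) ⟩
  2 * (surj (suc n) 2 + surj (suc n) 1) + 2     ≡⟨ cong (λ x → 2 * (surj (suc n) 2 + x) + 2) (surj-one n) ⟩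
  2 * (surj (suc n) 2 + 1) + 2                  ≡⟨ shuffle (surj (suc n) 2) ⟩
  2 * (surj (suc n) 2 + 2)                      ≡⟨ cong (2 *_) (surj-two n) ⟩
  2 ^ (2 + n)                                   ∎
  where
  open ≡-Reasoning
  shuffle : ∀ a → 2 * (a + 1) + 2 ≡ 2 * (a + 2)
  shuffle = solve-∀

-- The identity h(u)² + h(u) = h(2u)/2 for h = (e^(2u) - 1)/2 in degree n + 1. All three terms carry
-- the same odd part of (n + 1)!, so it holds exactly.
surj′-one-two : ∀ n → surj′ 2 (suc n) + surj′ 1 (suc n) ≡ surj′ 1 (suc n) * 2 ^ n
surj′-one-two n = *-cancelˡ-≡ _ _ 4 (begin
  4 * (x₂ + x₁)                                  ≡⟨ shuffle₁ x₁ x₂ ⟩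
  2 ^ 2 * x₂ + 2 ^ 1 * x₁ * 2                    ≡⟨ cong₂ (λ a b → a + b * 2)
                                                      (surj-surj′ 2 (suc n)) (surj-surj′ 1 (suc n)) ⟨
  p * surj (suc n) 2 + p * surj (suc n) 1 * 2    ≡⟨ cong (λ a → p * surj (suc n) 2 + p * a * 2) (surj-one n) ⟩
  p * surj (suc n) 2 + p * 1 * 2                 ≡⟨ shuffle₂ p (surj (suc n) 2) ⟩
  p * 1 * (surj (suc n) 2 + 2)                   ≡⟨ cong₂ (λ a b → p * a * b) (sym (surj-one n)) (surj-two n) ⟩
  p * surj (suc n) 1 * 2 ^ suc n                 ≡⟨ cong (_* 2 ^ suc n) (surj-surj′ 1 (suc n)) ⟩
  2 ^ 1 * x₁ * (2 * 2 ^ n)                       ≡⟨ shuffle₃ x₁ (2 ^ n) ⟩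
  4 * (x₁ * 2 ^ n)                               ∎)
  where
  open ≡-Reasoning
  x₁ = surj′ 1 (suc n)
  x₂ = surj′ 2 (suc n)
  p = 2 ^ s₂ (suc n)
  shuffle₁ : ∀ a b → 4 * (b + a) ≡ 4 * b + 2 * a * 2
  shuffle₁ = solve-∀
  shuffle₂ : ∀ p a → p * a + p * 1 * 2 ≡ p * 1 * (a + 2)
  shuffle₂ = solve-∀
  shuffle₃ : ∀ a q → 2 * a * (2 * q) ≡ 4 * (a * q)
  shuffle₃ = solve-∀

-- Unlike `weight`, `weight₂` ignores its second index, so sums shifted against each other in j
-- share a common factor.
conv₂ : ℕ → ℕ → ℕ
conv₂ k = antidiagonal (λ i j → weight₂ i j * surj′ k j)

surj′-suc-parity : ∀ k n → parity (surj′ (suc k) n) ≡ parity (conv₂ k n)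
surj′-suc-parity k n = antidiagonal-parity n λ i j → begin
  parity (weight i j * surj′ k j)             ≡⟨ *-homo-* (weight i j) (surj′ k j) ⟩
  parity (weight i j) ℙ.* parity (surj′ k j)  ≡⟨ cong (ℙ._* parity (surj′ k j)) (weight-parity i j) ⟩
  parity (weight₂ i j) ℙ.* parity (surj′ k j) ≡⟨ *-homo-* (weight₂ i j) (surj′ k j) ⟨
  parity (weight₂ i j * surj′ k j)            ∎
  where open ≡-Reasoning

parity-+-cong : ∀ a a′ b b′ → parity a ≡ parity a′ → parity b ≡ parity b′ →
  parity (a + b) ≡ parity (a′ + b′)
parity-+-cong a a′ b b′ eq eq′ =
  trans (+-homo-+ a b) (trans (cong₂ ℙ._+_ eq eq′) (sym (+-homo-+ a′ b′)))

-- With g = Σᵣ u^(2^r), this is g^(k+2) + g^(k+1) + u g^k ≡ 0 (mod 2), a multiple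
-- of g² + g + u ≡ 0.
surj′-rec : ∀ k n → parity (surj′ (2 + k) (suc n) + surj′ (1 + k) (suc n) + surj′ k n) ≡ 0ℙ
surj′-rec zero zero    = trans (cong (λ a → parity (a + 1)) (surj′-one-two 0)) one
  where
  one : parity (surj′ 1 1 * 1 + 1) ≡ 0ℙ
  one = cong (λ a → parity (a * 1 + 1)) (*-cancelˡ-≡ (surj′ 1 1) 1 2 (sym (surj-surj′ 1 1)))
-- Above degree one, h(2u)/2 has even coefficients, and `surj′ 0` contributes 0.
surj′-rec zero (suc n) = begin
  parity (surj′ 2 (2 + n) + x₁ + 0)    ≡⟨ cong parity (+-identityʳ (surj′ 2 (2 + n) + x₁)) ⟩
  parity (surj′ 2 (2 + n) + x₁)        ≡⟨ cong parity (surj′-one-two (suc n)) ⟩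
  parity (x₁ * (2 * 2 ^ n))            ≡⟨ cong parity (x∙yz≈y∙xz *-commutativeSemigroup x₁ 2 (2 ^ n)) ⟩
  parity (2 * (x₁ * 2 ^ n))            ≡⟨ parity-double (x₁ * 2 ^ n) ⟩
  0ℙ                                   ∎
  where
  open ≡-Reasoning
  x₁ = surj′ 1 (2 + n)
surj′-rec (suc k) n = begin
  parity (surj′ (3 + k) (suc n) + surj′ (2 + k) (suc n) + surj′ (suc k) n)
    ≡⟨ parity-+-cong (surj′ (3 + k) (suc n) + surj′ (2 + k) (suc n))
         (conv₂ (2 + k) (suc n) + conv₂ (suc k) (suc n)) (surj′ (suc k) n) (conv₂ k n)
         (parity-+-cong (surj′ (3 + k) (suc n)) (conv₂ (2 + k) (suc n))
           (surj′ (2 + k) (suc n)) (conv₂ (suc k) (suc n))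
           (surj′-suc-parity (2 + k) (suc n)) (surj′-suc-parity (suc k) (suc n)))
         (surj′-suc-parity k n) ⟩
  parity (conv₂ (2 + k) (suc n) + conv₂ (suc k) (suc n) + conv₂ k n)
    ≡⟨ cong parity (cong₂ (λ a b → a + b + conv₂ k n) (shift (suc k)) (shift k)) ⟩
  parity (antidiagonal (f (2 + k)) n + antidiagonal (f (suc k)) n + conv₂ k n)
    ≡⟨ cong parity (trans (antidiagonal-+ _ _ n)
         (cong (_+ conv₂ k n) (antidiagonal-+ (f (2 + k)) (f (suc k)) n))) ⟨
  parity (antidiagonal (λ i j → f (2 + k) i j + f (suc k) i j + weight₂ i j * surj′ k j) n)
    ≡⟨ antidiagonal-parity n vanish ⟩
  parity (antidiagonal (λ _ _ → 0) n)
    ≡⟨ cong parity (antidiagonal-zero n) ⟩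
  0ℙ ∎
  where
  open ≡-Reasoning
  f : ℕ → ℕ → ℕ → ℕ
  f l i j = weight₂ i j * surj′ l (suc j)
  -- The term j = 0 vanishes since h has no constant term; without it all three sums run over i + j
  -- = n, and `weight₂ i j` factors out.
  shift : ∀ l → conv₂ (suc l) (suc n) ≡ antidiagonal (f (suc l)) n
  shift l = begin
    conv₂ (suc l) (suc n)
      ≡⟨ antidiagonal-last (λ i j → weight₂ i j * surj′ (suc l) j) n ⟩
    antidiagonal (f (suc l)) n + weight₂ (suc n) 0 * 0
      ≡⟨ cong (antidiagonal (f (suc l)) n +_) (*-zeroʳ (weight₂ (suc n) 0)) ⟩
    antidiagonal (f (suc l)) n + 0
      ≡⟨ +-identityʳ _ ⟩
    antidiagonal (f (suc l)) n ∎
  vanish : ∀ i j → parity (f (2 + k) i j + f (suc k) i j + weight₂ i j * surj′ k j) ≡ parity 0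
  vanish i j = begin
    parity (w * x + w * y + w * z)           ≡⟨ cong parity (factor w x y z) ⟩
    parity (w * (x + y + z))                 ≡⟨ *-homo-* w (x + y + z) ⟩
    parity w ℙ.* parity (x + y + z)          ≡⟨ cong (parity w ℙ.*_) (surj′-rec k j) ⟩
    parity w ℙ.* 0ℙ                          ≡⟨ ℙ.*-zeroʳ (parity w) ⟩
    0ℙ                                       ∎
    where
    w = weight₂ i j
    x = surj′ (2 + k) (suc j)
    y = surj′ (1 + k) (suc j)
    z = surj′ k j
    factor : ∀ w x y z → w * x + w * y + w * z ≡ w * (x + y + z)
    factor = solve-∀

parity-middle : ∀ a b c → parity (a + b + c) ≡ 0ℙ → parity b ≡ parity (a + c)
parity-middle a b c eq = begin
  parity b                ≡⟨ bits (parity a) (parity b) (parity c) (trans (sym +-homo-+₃) eq) ⟩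
  parity a ℙ.+ parity c   ≡⟨ +-homo-+ a c ⟨
  parity (a + c)          ∎
  where
  open ≡-Reasoning
  +-homo-+₃ : parity (a + b + c) ≡ parity a ℙ.+ parity b ℙ.+ parity c
  +-homo-+₃ = trans (+-homo-+ (a + b) c) (cong (ℙ._+ parity c) (+-homo-+ a b))
  bits : ∀ a b c → a ℙ.+ b ℙ.+ c ≡ 0ℙ → b ≡ a ℙ.+ c
  bits 0ℙ 0ℙ 0ℙ _ = refl
  bits 0ℙ 1ℙ 1ℙ _ = refl
  bits 1ℙ 0ℙ 1ℙ _ = refl
  bits 1ℙ 1ℙ 0ℙ _ = refl

-- Here N = k + m, so the claimed value is C(2N - k, m) = C(2N - k, N). Solving the recurrence for
-- its middle term gives Pascal's rule; the induction is on m and then on k, since `2 + k` occurs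
-- only with a smaller m.
surj′-binom : ∀ m k → parity (surj′ k (k + m)) ≡ parity (binom m (k + m))
surj′-binom zero    zero    = refl
surj′-binom zero    (suc k) = begin
  parity (surj′ (suc k) (suc k + 0))
    ≡⟨ parity-middle (surj′ (2 + k) (suc k + 0)) (surj′ (suc k) (suc k + 0)) (surj′ k (k + 0))
         (surj′-rec k (k + 0)) ⟩
  parity (surj′ (2 + k) (suc k + 0) + surj′ k (k + 0))
    ≡⟨ cong (λ a → parity (a + surj′ k (k + 0)))
         (surj′-above (2 + k) (suc k + 0) (s≤s (s≤s (≤-reflexive (+-identityʳ k))))) ⟩
  parity (surj′ k (k + 0))
    ≡⟨ surj′-binom zero k ⟩
  1ℙ ∎
  where open ≡-Reasoning
-- Boundary k = 0: the power g⁰ has no terms of positive degree, and a central binomial coefficient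
-- is twice a neighbour in the previous row.
surj′-binom (suc m) zero    = sym (begin
  parity (binom (suc m) (suc m))               ≡⟨ cong parity (binom-pascal m m) ⟩
  parity (binom m (suc m) + binom (suc m) m)   ≡⟨ cong (λ b → parity (binom m (suc m) + b))
                                                     (trans (binom-sym (suc m) m) (sym (+-identityʳ _))) ⟩
  parity (2 * binom m (suc m))                 ≡⟨ parity-double (binom m (suc m)) ⟩
  0ℙ                                           ∎)
  where open ≡-Reasoning
surj′-binom (suc m) (suc k) = begin
  parity (surj′ (suc k) (suc k + suc m))
    ≡⟨ parity-middle (surj′ (2 + k) (suc k + suc m)) (surj′ (suc k) (suc k + suc m))
         (surj′ k (k + suc m)) (surj′-rec k (k + suc m)) ⟩
  parity (surj′ (2 + k) (suc k + suc m) + surj′ k (k + suc m))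
    ≡⟨ parity-+-cong (surj′ (2 + k) (suc k + suc m)) (binom m (suc k + suc m))
         (surj′ k (k + suc m)) (binom (suc m) (k + suc m))
         (subst (λ l → parity (surj′ (2 + k) l) ≡ parity (binom m l)) (sym (+-suc (suc k) m)) (surj′-binom m (2 + k)))
         (surj′-binom (suc m) k) ⟩
  parity (binom m (suc k + suc m) + binom (suc m) (k + suc m))
    ≡⟨ cong parity (binom-pascal m (k + suc m)) ⟨
  parity (binom (suc m) (suc k + suc m)) ∎
  where open ≡-Reasoning

-- The valuation

S-surj′ : ∀ n k → ∃ λ o → Odd o × 2 ^ s₂ n * (S n k * o) ≡ 2 ^ s₂ k * surj′ k n
S-surj′ n k with o , o-odd , eq ← legendre k = o , o-odd , *-cancelˡ-≡ _ _ (2 ^ k) {{m^n≢0 2 k}} (begin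
  2 ^ k * (2 ^ s₂ n * (S n k * o))          ≡⟨ shuffle₁ (2 ^ k) (2 ^ s₂ n) (S n k) o ⟩
  2 ^ s₂ n * S n k * (2 ^ k * o)            ≡⟨ cong (2 ^ s₂ n * S n k *_) eq ⟨
  2 ^ s₂ n * S n k * (2 ^ s₂ k * k !)       ≡⟨ shuffle₂ (2 ^ s₂ n) (S n k) (2 ^ s₂ k) (k !) ⟩
  2 ^ s₂ k * (2 ^ s₂ n * surj n k)          ≡⟨ cong (2 ^ s₂ k *_) (surj-surj′ k n) ⟩
  2 ^ s₂ k * (2 ^ k * surj′ k n)            ≡⟨ x∙yz≈y∙xz *-commutativeSemigroup (2 ^ s₂ k) (2 ^ k) (surj′ k n) ⟩
  2 ^ k * (2 ^ s₂ k * surj′ k n)            ∎)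
  where
  open ≡-Reasoning
  shuffle₁ : ∀ a b s o → a * (b * (s * o)) ≡ b * s * (a * o)
  shuffle₁ = solve-∀
  shuffle₂ : ∀ a s b f → a * s * (b * f) ≡ b * (a * (f * s))
  shuffle₂ = solve-∀

ν₂-S : ∀ n k v → s₂ k ≡ s₂ n + v → Odd (surj′ k n) → ν₂[ S n k ]≡ v
ν₂-S n k v s≡ x-odd =
  let o , o-odd , eq = S-surj′ n k
      z , S≡ , zo≡x = cancel-odd v (S n k) (surj′ k n) o o-odd
        (*-cancelˡ-≡ _ _ (2 ^ s₂ n) {{m^n≢0 2 (s₂ n)}} (trans eq split))
  in ν₂-2^*odd v z (Odd-*⁻ˡ z o (trans (cong parity zo≡x) x-odd)) S≡
  where
  open ≡-Reasoning
  split : 2 ^ s₂ k * surj′ k n ≡ 2 ^ s₂ n * (2 ^ v * surj′ k n)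
  split = begin
    2 ^ s₂ k * surj′ k n             ≡⟨ cong (λ e → 2 ^ e * surj′ k n) s≡ ⟩
    2 ^ (s₂ n + v) * surj′ k n       ≡⟨ cong (_* surj′ k n) (^-distribˡ-+-* 2 (s₂ n) v) ⟩
    2 ^ s₂ n * 2 ^ v * surj′ k n     ≡⟨ *-assoc (2 ^ s₂ n) (2 ^ v) (surj′ k n) ⟩
    2 ^ s₂ n * (2 ^ v * surj′ k n)   ∎

-- Without carries the powers of 2 on both sides of `kummer` coincide, so the binomial coefficient
-- is the odd cofactor itself.
Odd-binom : ∀ m c n → m < 2 ^ n → Odd (binom m (c * 2 ^ n))
Odd-binom m c n m<2ⁿ =
  let q , q-odd , eq = kummer m (c * 2 ^ n)
      e = s₂ m + s₂ (c * 2 ^ n)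
  in trans (cong parity (*-cancelˡ-≡ (binom m (c * 2 ^ n)) q (2 ^ e) {{m^n≢0 2 e}}
       (trans (cong (λ l → 2 ^ l * binom m (c * 2 ^ n)) (sym no-carry)) eq))) q-odd
  where
  open ≡-Reasoning
  no-carry : s₂ (m + c * 2 ^ n) ≡ s₂ m + s₂ (c * 2 ^ n)
  no-carry = begin
    s₂ (m + c * 2 ^ n)       ≡⟨ cong s₂ (+-comm m _) ⟩
    s₂ (c * 2 ^ n + m)       ≡⟨ s₂-shift n c m m<2ⁿ ⟩
    s₂ c + s₂ m              ≡⟨ +-comm (s₂ c) (s₂ m) ⟩
    s₂ m + s₂ c              ≡⟨ cong (s₂ m +_) (s₂-*2^ n c) ⟨
    s₂ m + s₂ (c * 2 ^ n)    ∎

s₂-index : ∀ d n a → 1 ≤ a → a ≤ 2 ^ n →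
  s₂ (2 * d * 2 ^ n + a) ≡ s₂ (suc (2 * d) * 2 ^ n) + (s₂ a ∸ 1)
s₂-index d n (suc a) _ a≤2ⁿ with m≤n⇒m<n∨m≡n a≤2ⁿ
... | inj₁ a<2ⁿ with r , s≡ ← s₂-suc≢0 a = begin
  s₂ (2 * d * 2 ^ n + suc a)                      ≡⟨ s₂-shift n (2 * d) (suc a) a<2ⁿ ⟩
  s₂ (2 * d) + s₂ (suc a)                         ≡⟨ cong₂ _+_ (s₂-double d) s≡ ⟩
  s₂ d + suc r                                    ≡⟨ +-suc (s₂ d) r ⟩
  suc (s₂ d) + r                                  ≡⟨ cong (_+ r) (trans (s₂-*2^ n (suc (2 * d))) (s₂-suc-double d)) ⟨
  s₂ (suc (2 * d) * 2 ^ n) + r                    ≡⟨ cong (λ l → s₂ (suc (2 * d) * 2 ^ n) + (l ∸ 1)) s≡ ⟨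
  s₂ (suc (2 * d) * 2 ^ n) + (s₂ (suc a) ∸ 1)     ∎
  where open ≡-Reasoning
-- For a = 2ⁿ the digits of a no longer lie below position n; here k equals N, and both sides agree
-- because a has digit sum 1.
... | inj₂ a≡2ⁿ = begin
  s₂ (2 * d * 2 ^ n + suc a)                      ≡⟨ cong (λ l → s₂ (2 * d * 2 ^ n + l)) a≡2ⁿ ⟩
  s₂ (2 * d * 2 ^ n + 2 ^ n)                      ≡⟨ cong s₂ (+-comm (2 * d * 2 ^ n) (2 ^ n)) ⟩
  s₂ (suc (2 * d) * 2 ^ n)                        ≡⟨ +-identityʳ _ ⟨
  s₂ (suc (2 * d) * 2 ^ n) + 0                    ≡⟨ cong (λ l → s₂ (suc (2 * d) * 2 ^ n) + (l ∸ 1)) s≡1 ⟨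
  s₂ (suc (2 * d) * 2 ^ n) + (s₂ (suc a) ∸ 1)     ∎
  where
  open ≡-Reasoning
  s≡1 : s₂ (suc a) ≡ 1
  s≡1 = trans (cong s₂ (trans a≡2ⁿ (sym (*-identityˡ (2 ^ n))))) (s₂-*2^ n 1)

theorem1p2 : (a c n : ℕ) → 1 ≤ c → 2 ∤ c → 2 ≤ n → 1 ≤ a → a ≤ 2 ^ n →
    ν₂[ S (c * 2 ^ n) ((c ∸ 1) * 2 ^ n + a) ]≡ (s₂ a ∸ 1)
theorem1p2 a c n _ 2∤c _ 1≤a a≤2ⁿ with halve c
... | even d = contradiction (m∣m*n d) 2∤c
... | odd  d = ν₂-S N k (s₂ a ∸ 1) (s₂-index d n a 1≤a a≤2ⁿ)
  (subst (λ l → Odd (surj′ k l)) k+m≡N (trans (surj′-binom m k)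
    (subst (λ l → Odd (binom m l)) (sym k+m≡N) (Odd-binom m (suc (2 * d)) n m<2ⁿ))))
  where
  open ≡-Reasoning
  N = suc (2 * d) * 2 ^ n
  k = 2 * d * 2 ^ n + a
  m = 2 ^ n ∸ a
  m<2ⁿ : m < 2 ^ n
  -- Positivity of a makes this strict, keeping the digits of m below those of N.
  m<2ⁿ = ∸-monoʳ-< 1≤a a≤2ⁿ
  k+m≡N : k + m ≡ N
  k+m≡N = begin
    2 * d * 2 ^ n + a + (2 ^ n ∸ a)     ≡⟨ +-assoc (2 * d * 2 ^ n) a _ ⟩
    2 * d * 2 ^ n + (a + (2 ^ n ∸ a))   ≡⟨ cong (2 * d * 2 ^ n +_) (m+[n∸m]≡n a≤2ⁿ) ⟩
    2 * d * 2 ^ n + 2 ^ n               ≡⟨ +-comm (2 * d * 2 ^ n) (2 ^ n) ⟩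
    N                                   ∎
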